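{- Let $d\ge 1$ be a natural number and let $A$ and $B$ be subsets of $\mathbb{Z}^{d}$ such that $\overline{\operatorname{d}}(A)=\alpha>0$ and $\operatorname{BD}(B)>0$. Then $A+B$ is upper syndetic of level $\alpha$.
   Context: Intervals denote intervals of integers, $\mathbb{N}$ does not contain $0$, and $A+B=\{a+b:a\in A,b\in B\}$. For $A\subseteq\mathbb{Z}^d$, the upper (asymptotic) density is $\overline{\operatorname{d}}(A)=\limsup_{n\to\infty}\frac{|A\cap[-n,n]^d|}{(2n+1)^d}$, and the (upper) Banach density is $\operatorname{BD}(A)=\lim_{n\to\infty}\sup_{x\in\mathbb{Z}^d}\frac{|A\cap(x+[-n,n]^d)|}{(2n+1)^d}$. For a real number $0<\alpha\le 1$, a set $C\subseteq\mathbb{Z}^d$ is upper syndetic of level $\alpha$ if there exists a natural number $m$ (with $m=0$ allowed) such that for all $k\in\mathbb{N}$, $\overline{\operatorname{d}}(\{z\in\mathbb{Z}^d: z+[-k,k]^d\subseteq C+[-m,m]^d\})\ge\alpha$. -}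

module Defs where

open import Level using (0ℓ)
open import Axiom.ExcludedMiddle using (ExcludedMiddle)
open import Data.Nat as ℕ using (ℕ; zero; suc; s≤s; z≤n)
import Data.Nat.Properties as ℕ
open import Data.Integer as ℤ using (ℤ; +_; ∣_∣)
import Data.Integer.Properties as ℤ
open import Data.Rational as ℚ using (ℚ; 0ℚ; 1ℚ; _/_)
import Data.Rational.Properties as ℚ
import Data.Rational.Unnormalised as ℚᵘ
import Data.Rational.Unnormalised.Properties as ℚᵘ
open import Data.List using (List; []; _∷_; length; map; filter; applyUpTo; cartesianProductWith)
open import Data.List.Properties using (length-map; length-filter; length-applyUpTo; length-++)
open import Data.List.Membership.Propositional using () renaming (_∈_ to _∈ˡ_)
open import Data.List.Membership.Propositional.Properties
  using (∈-applyUpTo⁺; ∈-applyUpTo⁻; ∈-cartesianProductWith⁺; ∈-cartesianProductWith⁻)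
open import Data.List.Relation.Unary.Any using (here)
open import Data.List.Relation.Unary.Unique.Propositional using (Unique)
import Data.List.Relation.Unary.Unique.Propositional.Properties as Unique
import Data.List.Relation.Unary.AllPairs as AllPairs
import Data.List.Relation.Unary.All as Allˡ
open import Data.Vec using (Vec; []; _∷_; zipWith; replicate)
open import Data.Vec.Properties using (∷-injective)
open import Data.Vec.Relation.Unary.All using (All; []; _∷_)
open import Data.Product using (∃; _×_; _,_; proj₁; proj₂)
open import Data.Sum using (_⊎_; inj₁; inj₂)
open import Function using (_∘_; _⇔_; mk⇔)
open import Relation.Binary.PropositionalEquality
open import Relation.Unary using (Pred; _∈_; _∉_; _⊆_; ｛_｝)

-- A real number is a left Dedekind cut: a proper, nonempty, downward closed
-- set of rationals without a greatest element, thought of as {q : q < x}.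
-- One-sided cuts are only the usual reals classically; every use of them below
-- is under the assumption of excluded middle.

record ℝ : Set₁ where
  field
    below     : Pred ℚ 0ℓ
    inhabited : ∃ λ q → q ∈ below
    proper    : ∃ λ q → q ∉ below
    downward  : ∀ {p q} → p ℚ.< q → q ∈ below → p ∈ below
    open′     : ∀ {p} → p ∈ below → ∃ λ q → p ℚ.< q × q ∈ below

open ℝ public

infix 4 _≤ʳ_ _<ʳ_ _≈ʳ_
infixl 6 _+ʳ_

_≤ʳ_ _<ʳ_ _≈ʳ_ : ℝ → ℝ → Set
x ≤ʳ y = below x ⊆ below y
x <ʳ y = ∃ λ q → q ∈ below y × q ∉ below x
x ≈ʳ y = x ≤ʳ y × y ≤ʳ x

private
  p-1<p : ∀ p → p ℚ.- 1ℚ ℚ.< p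
  p-1<p p = subst (p ℚ.- 1ℚ ℚ.<_) (ℚ.+-identityʳ p)
              (ℚ.+-monoʳ-< p (ℚ.negative⁻¹ (ℚ.- 1ℚ)))

  p-r+r : ∀ p r → (p ℚ.- r) ℚ.+ r ≡ p
  p-r+r p r = trans (ℚ.+-assoc p (ℚ.- r) r)
                (trans (cong (p ℚ.+_) (ℚ.+-inverseˡ r)) (ℚ.+-identityʳ p))

  p+r-r : ∀ p r → (p ℚ.+ r) ℚ.- r ≡ p
  p+r-r p r = trans (ℚ.+-assoc p r (ℚ.- r))
                (trans (cong (p ℚ.+_) (ℚ.+-inverseʳ r)) (ℚ.+-identityʳ p))

fromℚ : ℚ → ℝ
fromℚ r = record
  { below     = ℚ._< r
  ; inhabited = r ℚ.- 1ℚ , p-1<p r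
  ; proper    = r , ℚ.<-irrefl refl
  ; downward  = ℚ.<-trans
  ; open′     = ℚ.<-dense
  }

0ʳ 1ʳ : ℝ
0ʳ = fromℚ 0ℚ
1ʳ = fromℚ 1ℚ

_+ʳ_ : ℝ → ℚ → ℝ
x +ʳ r = record
  { below     = λ q → q ℚ.- r ∈ below x
  ; inhabited = let (q , q∈) = inhabited x in
                q ℚ.+ r , subst (below x) (sym (p+r-r q r)) q∈
  ; proper    = let (q , q∉) = proper x in
                q ℚ.+ r , q∉ ∘ subst (below x) (p+r-r q r)
  ; downward  = λ p<q → downward x (ℚ.+-monoˡ-< (ℚ.- r) p<q)
  ; open′     = λ {p} p∈ → let (q , p-r<q , q∈) = open′ x p∈ in
                q ℚ.+ r
                , subst (ℚ._< q ℚ.+ r) (p-r+r p r) (ℚ.+-monoˡ-< r p-r<q)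
                , subst (below x) (sym (p+r-r q r)) q∈
  }

-- Supremum and infimum of a nonempty bounded family (`i₀` witnesses that the
-- family is nonempty).

sup : {I : Set} (i₀ : I) (x : I → ℝ) (b : ℚ) → (∀ i → x i ≤ʳ fromℚ b) → ℝ
sup i₀ x b x≤b = record
  { below     = λ q → ∃ λ i → q ∈ below (x i)
  ; inhabited = let (q , q∈) = inhabited (x i₀) in q , i₀ , q∈
  ; proper    = b , λ (i , b∈) → ℚ.<-irrefl refl (x≤b i b∈)
  ; downward  = λ p<q (i , q∈) → i , downward (x i) p<q q∈
  ; open′     = λ (i , p∈) → let (q , p<q , q∈) = open′ (x i) p∈ in q , p<q , i , q∈
  }

-- The intersection of the cuts may have a greatest element, which is why it is
-- replaced by its interior.

inf : {I : Set} (i₀ : I) (x : I → ℝ) (b : ℚ) → (∀ i → fromℚ b ≤ʳ x i) → ℝ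
inf i₀ x b b≤x = record
  { below     = λ q → ∃ λ r → q ℚ.< r × (∀ i → r ∈ below (x i))
  ; inhabited = b ℚ.- 1ℚ ℚ.- 1ℚ , b ℚ.- 1ℚ , p-1<p _ , λ i → b≤x i (p-1<p b)
  ; proper    = let (q , q∉) = proper (x i₀) in
                q , λ (r , q<r , r∈) → q∉ (downward (x i₀) q<r (r∈ i₀))
  ; downward  = λ p<q (r , q<r , r∈) → r , ℚ.<-trans p<q q<r , r∈
  ; open′     = λ (r , p<r , r∈) → let (q , p<q , q<r) = ℚ.<-dense p<r in
                q , p<q , r , q<r , r∈
  }

limsup : (s : ℕ → ℝ) (a b : ℚ) → (∀ n → fromℚ a ≤ʳ s n) → (∀ n → s n ≤ʳ fromℚ b) → ℝ
limsup s a b a≤s s≤b =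
  inf 0 (λ n → sup 0 (λ k → s (n ℕ.+ k)) b (λ k → s≤b (n ℕ.+ k))) a
    (λ n q<a → 0 , a≤s (n ℕ.+ 0) q<a)

IsLimit : (ℕ → ℝ) → ℝ → Set
IsLimit s x = ∀ ε → 0ℚ ℚ.< ε →
  ∃ λ N → ∀ n → N ℕ.≤ n → s n <ʳ x +ʳ ε × x <ʳ s n +ʳ ε

infix 8 ℤ^_
infixl 6 _⊕_ _⊞_

ℤ^_ : ℕ → Set
ℤ^ d = Vec ℤ d

_⊕_ : ∀ {d} → ℤ^ d → ℤ^ d → ℤ^ d
_⊕_ = zipWith ℤ._+_

Subset : ℕ → Set₁
Subset d = Pred (ℤ^ d) 0ℓ

_⊞_ : ∀ {d} → Subset d → Subset d → Subset d
(A ⊞ B) z = ∃ λ a → ∃ λ b → a ∈ A × b ∈ B × z ≡ a ⊕ b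

Cube : ∀ {d} → ℕ → Subset d
Cube n = All (λ c → ∣ c ∣ ℕ.≤ n)

-- `cube d n` lists each element of `Cube n` exactly once, see `∈-cube` and
-- `cube-unique`.

interval : ℕ → List ℤ
interval n = applyUpTo (λ i → + i ℤ.- + n) (suc (2 ℕ.* n))

cube : ∀ d → ℕ → List (ℤ^ d)
cube zero    n = [] ∷ []
cube (suc d) n = cartesianProductWith _∷_ (interval n) (cube d n)

private
  i-n+n : ∀ i j → (i ℤ.- j) ℤ.+ j ≡ i
  i-n+n i j = trans (ℤ.+-assoc i (ℤ.- j) j)
                (trans (cong (λ t → i ℤ.+ t) (ℤ.+-inverseˡ j)) (ℤ.+-identityʳ i))

  c+n-n : ∀ i j → (i ℤ.+ j) ℤ.- j ≡ i
  c+n-n i j = trans (ℤ.+-assoc i j (ℤ.- j))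
                (trans (cong (λ t → i ℤ.+ t) (ℤ.+-inverseʳ j)) (ℤ.+-identityʳ i))

  2n≡n+n : ∀ n → 2 ℕ.* n ≡ n ℕ.+ n
  2n≡n+n n = cong (n ℕ.+_) (ℕ.+-identityʳ n)

  ∈-interval⁻ : ∀ n {c} → c ∈ˡ interval n → ∣ c ∣ ℕ.≤ n
  ∈-interval⁻ n c∈ with ∈-applyUpTo⁻ (λ i → + i ℤ.- + n) c∈
  ... | i , s≤s i≤2n , refl = subst (ℕ._≤ n) (sym (cong ∣_∣ (ℤ.m-n≡m⊖n i n))) (bound (ℕ.≤-total i n))
    where
    bound : i ℕ.≤ n ⊎ n ℕ.≤ i → ∣ i ℤ.⊖ n ∣ ℕ.≤ n
    bound (inj₁ i≤n) = subst (ℕ._≤ n) (sym (ℤ.∣⊖∣-≤ i≤n)) (ℕ.m∸n≤m n i)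
    bound (inj₂ n≤i) = subst (ℕ._≤ n) (sym (trans (ℤ.∣m⊖n∣≡∣n⊖m∣ i n) (ℤ.∣⊖∣-≤ n≤i)))
      (ℕ.m≤n+o⇒m∸n≤o i n (subst (i ℕ.≤_) (2n≡n+n n) i≤2n))

  ∈-interval⁺ : ∀ n c → ∣ c ∣ ℕ.≤ n → c ∈ˡ interval n
  ∈-interval⁺ n c ∣c∣≤n = subst (_∈ˡ interval n) shift≡c
    (∈-applyUpTo⁺ (λ i → + i ℤ.- + n) (s≤s shift≤2n))
    where
    shift : ∀ c → ∣ c ∣ ℕ.≤ n → ∃ λ i → i ℕ.≤ n ℕ.+ n × + i ≡ c ℤ.+ + n
    shift (+ m)       m≤n = m ℕ.+ n , ℕ.+-monoˡ-≤ n m≤n , refl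
    shift ℤ.-[1+ m ]  m<n = n ℕ.∸ suc m , ℕ.≤-trans (ℕ.m∸n≤m n (suc m)) (ℕ.m≤m+n n n) , sym (ℤ.⊖-≥ m<n)
    i = proj₁ (shift c ∣c∣≤n)
    shift≤2n : i ℕ.≤ 2 ℕ.* n
    shift≤2n = subst (i ℕ.≤_) (sym (2n≡n+n n)) (proj₁ (proj₂ (shift c ∣c∣≤n)))
    shift≡c : + i ℤ.- + n ≡ c
    shift≡c = trans (cong (ℤ._- + n) (proj₂ (proj₂ (shift c ∣c∣≤n)))) (c+n-n c (+ n))

  interval-unique : ∀ n → Unique (interval n)
  interval-unique n = Unique.applyUpTo⁺₁ (λ i → + i ℤ.- + n) _
    (λ i<j _ eq → ℕ.<⇒≢ i<j (ℤ.+-injective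
      (trans (sym (i-n+n _ (+ n))) (trans (cong (ℤ._+ + n) eq) (i-n+n _ (+ n))))))

∈-cube : ∀ {d n} {z : ℤ^ d} → z ∈ˡ cube d n ⇔ z ∈ Cube n
∈-cube {d} {n} = mk⇔ (to d) (from _)
  where
  to : ∀ d {z} → z ∈ˡ cube d n → z ∈ Cube n
  to zero    (here refl) = []
  to (suc d) z∈ with ∈-cartesianProductWith⁻ _∷_ (interval n) (cube d n) z∈
  ... | _ , _ , c∈ , z′∈ , refl = ∈-interval⁻ n c∈ ∷ to d z′∈
  from : ∀ {d} (z : ℤ^ d) → z ∈ Cube n → z ∈ˡ cube d n
  from []      []            = here refl
  from (c ∷ z) (c≤n ∷ z∈) = ∈-cartesianProductWith⁺ _∷_ (∈-interval⁺ n c c≤n) (from z z∈)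

cube-unique : ∀ d n → Unique (cube d n)
cube-unique zero    n = Allˡ.[] AllPairs.∷ AllPairs.[]
cube-unique (suc d) n =
  Unique.cartesianProductWith⁺ _∷_ ∷-injective (interval-unique n) (cube-unique d n)

translate : ∀ {d} → ℤ^ d → List (ℤ^ d) → List (ℤ^ d)
translate x = map (x ⊕_)

private
  length-product : ∀ {A B C : Set} (f : A → B → C) xs ys →
                   length (cartesianProductWith f xs ys) ≡ length xs ℕ.* length ys
  length-product f []       ys = refl
  length-product f (x ∷ xs) ys = trans (length-++ (map (f x) ys))
    (cong₂ ℕ._+_ (length-map (f x) ys) (length-product f xs ys))

length-cube : ∀ d n → length (cube d n) ≡ suc (2 ℕ.* n) ℕ.^ d
length-cube zero    n = refl
length-cube (suc d) n = trans (length-product _∷_ (interval n) (cube d n))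
  (cong₂ ℕ._*_ (length-applyUpTo (λ i → + i ℤ.- + n) (suc (2 ℕ.* n))) (length-cube d n))

private
  0≤ratio : ∀ c v .{{_ : ℕ.NonZero v}} → 0ℚ ℚ.≤ + c / v
  0≤ratio c v = ℚ.nonNegative⁻¹ (+ c / v) {{ℚ.normalize-nonNeg c v}}

  ratio≤1 : ∀ c v .{{_ : ℕ.NonZero v}} → c ℕ.≤ v → + c / v ℚ.≤ 1ℚ
  ratio≤1 c v@(suc v-1) c≤v = ℚ.toℚᵘ-cancel-≤ (ℚᵘ.≤-respˡ-≃
    (ℚᵘ.≃-sym (ℚ.toℚᵘ-fromℚᵘ (ℚᵘ.mkℚᵘ (+ c) v-1)))
    (ℚᵘ.*≤* (subst₂ ℤ._≤_ (sym (ℤ.*-identityʳ (+ c))) (sym (ℤ.*-identityˡ (+ v))) (ℤ.+≤+ c≤v))))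

-- Counting the elements of an arbitrary subset of a finite set requires
-- deciding membership, which is what excluded middle provides.

module Density (em : ExcludedMiddle 0ℓ) where

  count : ∀ {d} → Subset d → List (ℤ^ d) → ℕ
  count A F = length (filter (λ z → em {z ∈ A}) F)

  module _ {d : ℕ} where

    frequency : Subset d → ℕ → List (ℤ^ d) → ℚ
    frequency A n F = (+ count A F / (suc (2 ℕ.* n) ℕ.^ d)) {{ℕ.m^n≢0 (suc (2 ℕ.* n)) d}}

    frequency≥0 : ∀ A n F → fromℚ 0ℚ ≤ʳ fromℚ (frequency A n F)
    frequency≥0 A n F q<0 =
      ℚ.<-≤-trans q<0 (0≤ratio (count A F) _ {{ℕ.m^n≢0 (suc (2 ℕ.* n)) d}})

    frequency≤1 : ∀ A n F → length F ≡ length (cube d n) →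
                  fromℚ (frequency A n F) ≤ʳ fromℚ 1ℚ
    frequency≤1 A n F eq q<f =
      ℚ.<-≤-trans q<f (ratio≤1 (count A F) _ {{ℕ.m^n≢0 (suc (2 ℕ.* n)) d}}
        (subst (count A F ℕ.≤_) (trans eq (length-cube d n)) (length-filter _ F)))

    d̄ : Subset d → ℝ
    d̄ A = limsup (λ n → fromℚ (frequency A n (cube d n))) 0ℚ 1ℚ
            (λ n → frequency≥0 A n (cube d n))
            (λ n → frequency≤1 A n (cube d n) refl)

    maxFrequency : Subset d → ℕ → ℝ
    maxFrequency A n =
      sup (replicate d (+ 0)) (λ x → fromℚ (frequency A n (translate x (cube d n)))) 1ℚ
        (λ x → frequency≤1 A n (translate x (cube d n)) (length-map (x ⊕_) (cube d n)))

    -- The Banach density is a relation, `BD A ≈ β`, because it is defined by a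
    -- limit, whose existence would otherwise have to be proved first.

    infix 4 BD_≈_

    BD_≈_ : Subset d → ℝ → Set
    BD A ≈ β = IsLimit (maxFrequency A) β

    UpperSyndetic : ℝ → Subset d → Set
    UpperSyndetic α C =
      0ʳ <ʳ α × α ≤ʳ 1ʳ ×
      ∃ λ m → ∀ k → 1 ℕ.≤ k → α ≤ʳ d̄ (λ z → ｛ z ｝ ⊞ Cube k ⊆ C ⊞ Cube m)

{-# OPTIONS --safe #-}

-- Write A_m for A + [-m,m]^d and d* for the upper density. As m grows, d*(A_m)
-- increases to some limit D ≥ α, so for suitable m the density of A_r exceeds
-- that of A_m by little, however large r is. By double counting, for most
-- z ∈ A_m the cube z + [-r,r]^d contains few points outside A_m (such points lie
-- in A_{m+r}). If B fills a proportion 1/s of the cube x + [-K,K]^d and z + x + v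
-- is not in A + B + [-m,m]^d for some v ∈ [-k,k]^d, then every z + v − y with
-- y ∈ [-K,K]^d and x + y ∈ B lies outside A_m, which for k ≤ K and r = K + k is
-- too many points. So z + x + [-k,k]^d ⊆ A + B + [-m,m]^d for most z ∈ A_m. The
-- loss is at most a constant (depending on s and d) times the gap D − d*(A_m).
-- If D > α, some m makes up for the loss; if D = α, there is none with m = 0.

module Submission where

open import Defs
open import Level using (0ℓ)
open import Axiom.ExcludedMiddle using (ExcludedMiddle)
open import Data.Nat hiding (_/_)
open import Data.Nat.ListAction using (sum)
open import Data.Nat.Properties
open import Data.Nat.Tactic.RingSolver using (solve-∀)
open import Data.Integer as ℤ using (+_)
import Data.Integer.Properties as ℤ
import Data.Integer.Tactic.RingSolver as ℤ
open import Data.Rational as ℚ using (ℚ; 0ℚ; 1ℚ; _/_; mkℚ)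
import Data.Rational.Properties as ℚ
import Data.Rational.Unnormalised as ℚᵘ
import Data.Rational.Unnormalised.Properties as ℚᵘ
open import Data.List using (List; []; _∷_; [_]; _++_; length; map; filter)
open import Data.List.Properties using (length-map; length-++; length-filter)
open import Data.List.Membership.Propositional using () renaming (_∈_ to _∈ˡ_)
open import Data.List.Membership.Propositional.Properties
  using (∈-∃++; ∈-++⁺ˡ; ∈-++⁺ʳ; ∈-++⁻; ∈-map⁻; ∈-filter⁺; ∈-filter⁻)
open import Data.List.Relation.Unary.Any using (here; there)
import Data.List.Relation.Unary.All as Allˡ
open import Data.List.Relation.Unary.AllPairs using (_∷_)
open import Data.List.Relation.Unary.Unique.Propositional using (Unique)
import Data.List.Relation.Unary.Unique.Propositional.Properties as Unique
open import Data.Vec as Vec using ([]; _∷_; replicate)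
open import Data.Vec.Properties using (zipWith-identityʳ)
open import Data.Vec.Relation.Unary.All as All using ([]; _∷_)
open import Data.Product using (∃; ∃₂; _×_; _,_; proj₁; proj₂)
open import Data.Sum using (inj₁; inj₂; [_,_]′)
open import Data.Empty using (⊥-elim)
open import Function using (_∘_; Equivalence)
open import Relation.Nullary using (Dec; ¬_; yes; no)
open import Relation.Binary.PropositionalEquality hiding ([_])
open import Relation.Unary using (_∈_; _∉_; _⊆_; ｛_｝; ∁; _∩_)

-- Pigeonhole for lists without repetitions.

-- Each element of `xs` is struck out of `ys` as it is met; by uniqueness the later elements of `xs`
-- survive in what remains.
Unique-⊆⇒length≤ : ∀ {X : Set} {xs ys : List X} → Unique xs →
                   (∀ {x} → x ∈ˡ xs → x ∈ˡ ys) → length xs ≤ length ys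
Unique-⊆⇒length≤ {xs = []} _ _ = z≤n
Unique-⊆⇒length≤ {xs = x ∷ xs} (x∉xs ∷ u) xs⊆ys with ∈-∃++ (xs⊆ys (here refl))
... | as , bs , refl = begin
  suc (length xs)                 ≤⟨ s≤s (Unique-⊆⇒length≤ u rest) ⟩
  suc (length (as ++ bs))         ≡⟨ cong suc (length-++ as) ⟩
  suc (length as + length bs)     ≡⟨ +-suc (length as) (length bs) ⟨
  length as + length (x ∷ bs)     ≡⟨ length-++ as ⟨
  length (as ++ x ∷ bs)           ∎
  where
  open ≤-Reasoning
  rest : ∀ {y} → y ∈ˡ xs → y ∈ˡ as ++ bs
  rest y∈ with ∈-++⁻ as (xs⊆ys (there y∈))
  ... | inj₁ y∈as          = ∈-++⁺ˡ y∈as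
  ... | inj₂ (here refl)   = ⊥-elim (Allˡ.lookup x∉xs y∈ refl)
  ... | inj₂ (there y∈bs)  = ∈-++⁺ʳ as y∈bs

-- Arithmetic of ℤ^d, cubes and thickenings by cubes.

infix 9 ⊝_

⊝_ : ∀ {d} → ℤ^ d → ℤ^ d
⊝_ = Vec.map (ℤ.-_)

⊕-cancelʳ : ∀ {d} (x : ℤ^ d) {y z} → y ⊕ x ≡ z ⊕ x → y ≡ z
⊕-cancelʳ []      {[]}    {[]}    _  = refl
⊕-cancelʳ (c ∷ x) {a ∷ y} {b ∷ z} eq =
  cong₂ _∷_ (trans (sym (lem a c)) (trans (cong (ℤ._- c) (cong Vec.head eq)) (lem b c)))
            (⊕-cancelʳ x (cong Vec.tail eq))
  where
  lem : ∀ a c → (a ℤ.+ c) ℤ.- c ≡ a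
  lem = ℤ.solve-∀

⊝-injective : ∀ {d} {x y : ℤ^ d} → ⊝ x ≡ ⊝ y → x ≡ y
⊝-injective {x = []}    {[]}    _  = refl
⊝-injective {x = a ∷ x} {b ∷ y} eq =
  cong₂ _∷_ (ℤ.neg-injective (cong Vec.head eq)) (⊝-injective (cong Vec.tail eq))

⊕-identityʳ : ∀ {d} (x : ℤ^ d) → x ⊕ replicate d (+ 0) ≡ x
⊕-identityʳ = zipWith-identityʳ ℤ.+-identityʳ

⊕-assoc : ∀ {d} (x y z : ℤ^ d) → (x ⊕ y) ⊕ z ≡ x ⊕ (y ⊕ z)
⊕-assoc []      []      []      = refl
⊕-assoc (a ∷ x) (b ∷ y) (c ∷ z) = cong₂ _∷_ (ℤ.+-assoc a b c) (⊕-assoc x y z)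

-- z + x + v is the sum of a + e = z + v − y and x + y.
⊕-regroup : ∀ {d} {z x v y a e : ℤ^ d} → z ⊕ (⊝ y ⊕ v) ≡ a ⊕ e →
            (z ⊕ x) ⊕ v ≡ (a ⊕ (x ⊕ y)) ⊕ e
⊕-regroup {z = []} {[]} {[]} {[]} {[]} {[]} _ = refl
⊕-regroup {z = z ∷ _} {x ∷ _} {v ∷ _} {y ∷ _} {a ∷ _} {e ∷ _} eq =
  cong₂ _∷_ (trans (left z x v y) (trans (cong (λ t → (t ℤ.+ x) ℤ.+ y) (cong Vec.head eq))
              (right a e x y)))
            (⊕-regroup (cong Vec.tail eq))
  where
  left : ∀ z x v y → (z ℤ.+ x) ℤ.+ v ≡ ((z ℤ.+ (ℤ.- y ℤ.+ v)) ℤ.+ x) ℤ.+ y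
  left = ℤ.solve-∀
  right : ∀ a e x y → ((a ℤ.+ e) ℤ.+ x) ℤ.+ y ≡ (a ℤ.+ (x ℤ.+ y)) ℤ.+ e
  right = ℤ.solve-∀

Cube-⊕ : ∀ {d m n} {x y : ℤ^ d} → x ∈ Cube m → y ∈ Cube n → x ⊕ y ∈ Cube (m + n)
Cube-⊕ []                  []                  = []
Cube-⊕ (_∷_ {x = a} a≤m x∈) (_∷_ {x = b} b≤n y∈) =
  ≤-trans (ℤ.∣i+j∣≤∣i∣+∣j∣ a b) (+-mono-≤ a≤m b≤n) ∷ Cube-⊕ x∈ y∈

Cube-⊝ : ∀ {d n} {x : ℤ^ d} → x ∈ Cube n → ⊝ x ∈ Cube n
Cube-⊝ {x = []}    []          = []
Cube-⊝ {n = n} {x = a ∷ x} (a≤n ∷ x∈) = subst (_≤ n) (sym (ℤ.∣-i∣≡∣i∣ a)) a≤n ∷ Cube-⊝ x∈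

Cube-mono : ∀ {d m n} {x : ℤ^ d} → m ≤ n → x ∈ Cube m → x ∈ Cube n
Cube-mono m≤n = All.map (λ a≤m → ≤-trans a≤m m≤n)

Cube-exhaustive : ∀ {d} (x : ℤ^ d) → ∃ λ n → x ∈ Cube n
Cube-exhaustive []      = 0 , []
Cube-exhaustive (a ∷ x) with Cube-exhaustive x
... | n , x∈ = ℤ.∣ a ∣ + n , m≤m+n ℤ.∣ a ∣ n ∷ Cube-mono (m≤n+m n ℤ.∣ a ∣) x∈

0∈Cube : ∀ d {n} → replicate d (+ 0) ∈ Cube n
0∈Cube zero    = []
0∈Cube (suc d) = z≤n ∷ 0∈Cube d

⊞-Cube-⊕ : ∀ {d} {A : Subset d} {m n x y} → x ∈ A ⊞ Cube m → y ∈ Cube n → x ⊕ y ∈ A ⊞ Cube (m + n)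
⊞-Cube-⊕ {y = y} (a , e , a∈A , e∈ , refl) y∈ = a , e ⊕ y , a∈A , Cube-⊕ e∈ y∈ , ⊕-assoc a e y

⊆-⊞-Cube : ∀ {d} {A : Subset d} n → A ⊆ A ⊞ Cube n
⊆-⊞-Cube {d} n {x} x∈A = x , replicate d (+ 0) , x∈A , 0∈Cube d , sym (⊕-identityʳ x)

∈-cube⁺ : ∀ {d n} {z : ℤ^ d} → z ∈ Cube n → z ∈ˡ cube d n
∈-cube⁺ = Equivalence.from ∈-cube

∈-cube⁻ : ∀ {d n} {z : ℤ^ d} → z ∈ˡ cube d n → z ∈ Cube n
∈-cube⁻ = Equivalence.to ∈-cube

-- Fractions of natural numbers and their common denominators.

/-</ : ∀ a b c e .{{_ : NonZero b}} .{{_ : NonZero e}} → a * e < c * b → + a / b ℚ.< + c / e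
/-</ a b@(suc b-1) c e@(suc e-1) ae<cb = ℚ.toℚᵘ-cancel-<
  (ℚᵘ.<-respˡ-≃ (ℚᵘ.≃-sym (ℚ.toℚᵘ-fromℚᵘ (ℚᵘ.mkℚᵘ (+ a) b-1)))
  (ℚᵘ.<-respʳ-≃ (ℚᵘ.≃-sym (ℚ.toℚᵘ-fromℚᵘ (ℚᵘ.mkℚᵘ (+ c) e-1)))
  (ℚᵘ.*<* (subst₂ ℤ._<_ (ℤ.pos-* a e) (ℤ.pos-* c b) (ℤ.+<+ ae<cb)))))

/-</⁻ : ∀ a b c e .{{_ : NonZero b}} .{{_ : NonZero e}} → + a / b ℚ.< + c / e → a * e < c * b
/-</⁻ a b@(suc b-1) c e@(suc e-1) lt
  with ℚᵘ.<-respˡ-≃ (ℚ.toℚᵘ-fromℚᵘ (ℚᵘ.mkℚᵘ (+ a) b-1))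
         (ℚᵘ.<-respʳ-≃ (ℚ.toℚᵘ-fromℚᵘ (ℚᵘ.mkℚᵘ (+ c) e-1)) (ℚ.toℚᵘ-mono-< lt))
... | ℚᵘ.*<* ae<cb = ℤ.drop‿+<+ (subst₂ ℤ._<_ (sym (ℤ.pos-* a e)) (sym (ℤ.pos-* c b)) ae<cb)

/-≤/ : ∀ a b c e .{{_ : NonZero b}} .{{_ : NonZero e}} → a * e ≤ c * b → + a / b ℚ.≤ + c / e
/-≤/ a b c e ae≤cb = ℚ.≮⇒≥ (λ lt → <⇒≱ (/-</⁻ c e a b lt) ae≤cb)

nonNegative⇒/ : ∀ {p} → 0ℚ ℚ.≤ p → ∃₂ λ a b → p ≡ + a / suc b
nonNegative⇒/ {mkℚ (+ a) b c} _ = a , b , sym (ℚ.↥p/↧p≡p (mkℚ (+ a) b c))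
nonNegative⇒/ {mkℚ ℤ.-[1+ a ] b c} (ℚ.*≤* ())

-- Over the product of the two denominators the numerators differ by at least 1. Refining by the
-- factor `suc M` widens this to `suc M` steps, one of which makes `w` lie strictly above `p`.
common-denominator : ∀ {p q} M → 0ℚ ℚ.≤ p → p ℚ.< q →
  ∃ λ N → ∃₂ λ w u → p ℚ.< + w / suc N × + u / suc N ℚ.≤ q × w + M ≤ u
common-denominator {p} {q} M 0≤p p<q
  with nonNegative⇒/ 0≤p | nonNegative⇒/ (ℚ.≤-trans 0≤p (ℚ.<⇒≤ p<q))
... | a , b-1 , refl | c , e-1 , refl =
  N , w , u , /-</ a b w (suc N) above , /-≤/ u (suc N) c e below′ , gap
  where
  b e N w u : ℕ
  b = suc b-1
  e = suc e-1
  N = pred (b * e * suc M)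
  w = suc (a * e * suc M)
  u = c * b * suc M
  above : a * (b * e * suc M) < w * b
  above = begin-strict
    a * (b * e * suc M)     ≡⟨ lem a b e M ⟩
    (a * e * suc M) * b     <⟨ m<n+m ((a * e * suc M) * b) (s≤s (z≤n {b-1})) ⟩
    w * b                   ∎
    where
    open ≤-Reasoning
    lem : ∀ a b e M → a * (b * e * suc M) ≡ (a * e * suc M) * b
    lem = solve-∀
  below′ : u * e ≤ c * (b * e * suc M)
  below′ = ≤-reflexive (lem b c e M)
    where
    lem : ∀ b c e M → c * b * suc M * e ≡ c * (b * e * suc M)
    lem = solve-∀
  gap : w + M ≤ u
  gap = begin
    w + M                    ≡⟨ lem (a * e) M ⟩
    suc (a * e) * suc M      ≤⟨ *-monoˡ-≤ (suc M) (/-</⁻ a b c e p<q) ⟩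
    u                        ∎
    where
    open ≤-Reasoning
    lem : ∀ t M → suc (t * suc M) + M ≡ suc t * suc M
    lem = solve-∀

archimedean : ∀ {q} → 0ℚ ℚ.< q → ∃ λ N → + 1 / suc N ℚ.≤ q
archimedean 0<q =
  let (N , w , u , 0<w , u≤q , w≤u) = common-denominator 1 ℚ.≤-refl 0<q in
  N , ℚ.≤-trans (/-≤/ 1 (suc N) u (suc N) (*-monoˡ-≤ (suc N) (≤-trans (m≤n+m 1 w) w≤u))) u≤q

-- Growth of cube volumes and the budget of losses.

volume : ℕ → ℕ → ℕ
volume d n = suc (2 * n) ^ d

volume≢0 : ∀ d n → NonZero (volume d n)
volume≢0 d n = m^n≢0 (suc (2 * n)) d

volume-mono : ∀ d {m n} → m ≤ n → volume d m ≤ volume d n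
volume-mono d m≤n = ^-monoˡ-≤ d (s≤s (*-monoʳ-≤ 2 m≤n))

-- With M = 3(N + 1), the new factor and, by induction, the remaining power each grow at most by the
-- ratio 1 + 1/M, and (1 + 1/M)² ≤ 1 + 3/M = 1 + 1/(N + 1). The new factor needs u ≥ M e.
^-shift : ∀ d e N → ∃ λ u₀ → ∀ u → u₀ ≤ u → suc N * (u + e) ^ d ≤ suc (suc N) * u ^ d
^-shift zero    e N = 0 , λ u _ → *-monoˡ-≤ 1 (n≤1+n (suc N))
^-shift (suc d) e N with ^-shift d e (2 + 3 * N)
... | u₀ , shift = u₀ + M * e , step
  where
  M = 3 + 3 * N
  step : ∀ u → u₀ + M * e ≤ u → suc N * (u + e) ^ suc d ≤ suc (suc N) * u ^ suc d
  step u u≥ = *-cancelˡ-≤ (9 * suc N) (begin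
    9 * suc N * (suc N * ((u + e) * (u + e) ^ d))            ≡⟨ left N (u + e) ((u + e) ^ d) ⟩
    (M * (u + e)) * (M * (u + e) ^ d)                        ≤⟨ *-mono-≤ linear (shift u (≤-trans (m≤m+n u₀ _) u≥)) ⟩
    (suc M * u) * (suc M * u ^ d)                            ≤⟨ m≤m+n _ ((2 + 3 * N) * (u * u ^ d)) ⟩
    (suc M * u) * (suc M * u ^ d) + (2 + 3 * N) * (u * u ^ d) ≡⟨ right N u (u ^ d) ⟩
    9 * suc N * (suc (suc N) * (u * u ^ d))                  ∎)
    where
    open ≤-Reasoning
    left : ∀ N x y → 9 * suc N * (suc N * (x * y)) ≡ ((3 + 3 * N) * x) * ((3 + 3 * N) * y)
    left = solve-∀
    right : ∀ N x y → (suc (3 + 3 * N) * x) * (suc (3 + 3 * N) * y) + (2 + 3 * N) * (x * y) ≡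
                      9 * suc N * (suc (suc N) * (x * y))
    right = solve-∀
    linear : M * (u + e) ≤ suc M * u
    linear = begin
      M * (u + e)      ≡⟨ *-distribˡ-+ M u e ⟩
      M * u + M * e    ≤⟨ +-monoʳ-≤ (M * u) (≤-trans (m≤n+m (M * e) u₀) u≥) ⟩
      M * u + u        ≡⟨ +-comm (M * u) u ⟩
      suc M * u        ∎

volume-shift : ∀ d c N → ∃ λ n₀ → ∀ n → n₀ ≤ n →
               suc N * volume d (n + c) ≤ suc (suc N) * volume d n
volume-shift d c N with ^-shift d (2 * c) N
... | u₀ , shift = u₀ , λ n n≥ → subst (λ u → suc N * u ^ d ≤ suc (suc N) * volume d n) (lem n c)
                    (shift (suc (2 * n)) (≤-trans n≥ (m≤n⇒m≤1+n (m≤m+n n _))))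
  where
  lem : ∀ n c → suc (2 * n) + 2 * c ≡ suc (2 * (n + c))
  lem = solve-∀

-- Enlarging a window by `k ≤ K` costs only the factor 2^d, so the loss in the main estimate does
-- not depend on `k`.
volume-double : ∀ d {k K} → k ≤ K → volume d (K + k) ≤ 2 ^ d * volume d K
volume-double zero    k≤K = s≤s z≤n
volume-double (suc d) {k} {K} k≤K = begin
  suc (2 * (K + k)) * volume d (K + k)           ≤⟨ *-mono-≤ side (volume-double d k≤K) ⟩
  2 * suc (2 * K) * (2 ^ d * volume d K)         ≡⟨ swap (suc (2 * K)) (2 ^ d) (volume d K) ⟩
  2 * 2 ^ d * (suc (2 * K) * volume d K)         ∎
  where
  open ≤-Reasoning
  swap : ∀ x y z → 2 * x * (y * z) ≡ 2 * y * (x * z)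
  swap = solve-∀
  double : ∀ K → suc (suc (2 * (K + K))) ≡ 2 * suc (2 * K)
  double = solve-∀
  side : suc (2 * (K + k)) ≤ 2 * suc (2 * K)
  side = ≤-trans (m≤n⇒m≤1+n (s≤s (*-monoʳ-≤ 2 (+-monoʳ-≤ K k≤K)))) (≤-reflexive (double K))

-- a and h count A + Cube m and some larger A + Cube r in concentric cubes of volumes
-- V ≤ V′, a at density above j/N and h at density at most (j + 2)/N; g counts the
-- covered points, and e the points gained from a to h.
budget : ∀ {j w C N V V′ a e g h} → j * V < a * N → h * N ≤ (j + 2) * V′ → a ≤ V → V ≤ V′ →
         N * V′ ≤ suc N * V → a ≤ g + C * e → a + e ≤ h → w + (3 * C + 1) ≤ j → w * V′ < g * N
budget {j} {w} {C} {N} {V} {V′} {a} {e} {g} {h} jV<aN hN≤ a≤V V≤V′ NV′≤ a≤ a+e≤h w≤j =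
  +-cancelʳ-< ((3 * C + 1) * V′) (w * V′) (g * N) (begin-strict
    w * V′ + (3 * C + 1) * V′           ≡⟨ *-distribʳ-+ V′ w (3 * C + 1) ⟨
    (w + (3 * C + 1)) * V′              ≤⟨ *-monoˡ-≤ V′ w≤j ⟩
    j * V′                              <⟨ jV′<aN+V′ ⟩
    a * N + V′                          ≤⟨ +-monoˡ-≤ V′ (*-monoˡ-≤ N a≤) ⟩
    (g + C * e) * N + V′                ≡⟨ lem₁ g C e N V′ ⟩
    g * N + (C * (e * N) + V′)          ≤⟨ +-monoʳ-≤ (g * N) (+-monoˡ-≤ V′ (*-monoʳ-≤ C eN≤3V′)) ⟩
    g * N + (C * (3 * V′) + V′)         ≡⟨ cong (λ t → g * N + t) (lem₂ C V′) ⟩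
    g * N + (3 * C + 1) * V′            ∎)
  where
  open ≤-Reasoning
  lem₁ : ∀ g C e N V → (g + C * e) * N + V ≡ g * N + (C * (e * N) + V)
  lem₁ = solve-∀
  lem₂ : ∀ C V → C * (3 * V) + V ≡ (3 * C + 1) * V
  lem₂ = solve-∀
  j≤N : j ≤ N
  j≤N = <⇒≤ (*-cancelʳ-< V j N (<-≤-trans jV<aN
          (≤-trans (*-monoˡ-≤ N a≤V) (≤-reflexive (*-comm V N)))))
  t = N ∸ j
  -- As j ≤ N, the growth j(V′ - V) is at most N(V′ - V) ≤ V. Writing N = j + t avoids subtracting
  -- volumes.
  jV′≤jV+V : j * V′ ≤ j * V + V
  jV′≤jV+V = +-cancelʳ-≤ (t * V′) (j * V′) (j * V + V) (begin
    j * V′ + t * V′          ≡⟨ *-distribʳ-+ V′ j t ⟨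
    (j + t) * V′             ≡⟨ cong (_* V′) (m+[n∸m]≡n j≤N) ⟩
    N * V′                   ≤⟨ NV′≤ ⟩
    V + N * V                ≡⟨ cong (λ n → V + n * V) (m+[n∸m]≡n j≤N) ⟨
    V + (j + t) * V          ≡⟨ lem V j t ⟩
    (j * V + V) + t * V      ≤⟨ +-monoʳ-≤ (j * V + V) (*-monoʳ-≤ t V≤V′) ⟩
    (j * V + V) + t * V′     ∎)
    where
    lem : ∀ V j t → V + (j + t) * V ≡ (j * V + V) + t * V
    lem = solve-∀
  jV′<aN+V′ : j * V′ < a * N + V′
  jV′<aN+V′ = ≤-<-trans jV′≤jV+V (+-mono-<-≤ jV<aN V≤V′)
  -- Two of the three units are the gap between the levels `j` and `j + 2`; the third is the
  -- boundary loss in passing from `V` to `V′`.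
  eN≤3V′ : e * N ≤ 3 * V′
  eN≤3V′ = <⇒≤ (+-cancelˡ-< (j * V′) (e * N) (3 * V′) (begin-strict
    j * V′ + e * N           <⟨ +-monoˡ-< (e * N) jV′<aN+V′ ⟩
    a * N + V′ + e * N       ≡⟨ lem₃ a N V′ e ⟩
    (a + e) * N + V′         ≤⟨ +-monoˡ-≤ V′ (≤-trans (*-monoˡ-≤ N a+e≤h) hN≤) ⟩
    (j + 2) * V′ + V′        ≡⟨ lem₄ j V′ ⟩
    j * V′ + 3 * V′          ∎))
    where
    lem₃ : ∀ a N V e → a * N + V + e * N ≡ (a + e) * N + V
    lem₃ = solve-∀
    lem₄ : ∀ j V → (j + 2) * V + V ≡ j * V + 3 * V
    lem₄ = solve-∀

-- Classical reasoning and counting in finite lists.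

module _ (em : ExcludedMiddle 0ℓ) where
  open Density em

  ¬¬-elim : ∀ {P : Set} → ¬ ¬ P → P
  ¬¬-elim {P} ¬¬p with em {P}
  ... | yes p = p
  ... | no ¬p = ⊥-elim (¬¬p ¬p)

  last : (Q : ℕ → Set) → Q 0 → ∀ b → ¬ Q b → ∃ λ i → Q i × ¬ Q (suc i)
  last Q q₀ zero    ¬qb = ⊥-elim (¬qb q₀)
  last Q q₀ (suc b) ¬qb with em {Q b}
  ... | yes qb  = b , qb , ¬qb
  ... | no  ¬qb = last Q q₀ b ¬qb

  module _ {d : ℕ} where

    count-∷ : ∀ (P : Subset d) z F → count P (z ∷ F) ≡ count P [ z ] + count P F
    count-∷ P z F with em {z ∈ P}
    ... | yes _ = refl
    ... | no  _ = refl

    count-∈ : ∀ {P : Subset d} {z} → z ∈ P → count P [ z ] ≡ 1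
    count-∈ {P} {z} z∈P with em {z ∈ P}
    ... | yes _   = refl
    ... | no  z∉P = ⊥-elim (z∉P z∈P)

    count-∉ : ∀ {P : Subset d} {z} → z ∉ P → count P [ z ] ≡ 0
    count-∉ {P} {z} z∉P with em {z ∈ P}
    ... | yes z∈P = ⊥-elim (z∉P z∈P)
    ... | no  _   = refl

    count-injection : ∀ {P Q : Subset d} {F G} (f : ℤ^ d → ℤ^ d) → (∀ {y z} → f y ≡ f z → y ≡ z) →
      Unique F → (∀ {z} → z ∈ˡ F → z ∈ P → f z ∈ˡ G × f z ∈ Q) → count P F ≤ count Q G
    count-injection {P} {Q} {F} {G} f inj unique maps = begin
      count P F                        ≡⟨ length-map f (filter P? F) ⟨
      length (map f (filter P? F))     ≤⟨ Unique-⊆⇒length≤ (Unique.map⁺ inj (Unique.filter⁺ P? unique)) image ⟩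
      count Q G                        ∎
      where
      open ≤-Reasoning
      P? = λ z → em {z ∈ P}
      Q? = λ z → em {z ∈ Q}
      image : ∀ {y} → y ∈ˡ map f (filter P? F) → y ∈ˡ filter Q? G
      image y∈ with ∈-map⁻ f y∈
      ... | z , z∈ , refl with ∈-filter⁻ P? z∈
      ... | z∈F , z∈P = let (fz∈G , fz∈Q) = maps z∈F z∈P in ∈-filter⁺ Q? fz∈G fz∈Q

    count-mono : ∀ {P Q : Subset d} {F} → Unique F → (∀ {z} → z ∈ˡ F → z ∈ P → z ∈ Q) → count P F ≤ count Q F
    count-mono unique P⊆Q = count-injection (λ z → z) (λ eq → eq) unique (λ z∈F z∈P → z∈F , P⊆Q z∈F z∈P)

    count-split : ∀ (P Q : Subset d) F → count P F ≡ count (P ∩ Q) F + count (P ∩ ∁ Q) F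
    count-split P Q []      = refl
    count-split P Q (z ∷ F) = begin
      count P (z ∷ F)
        ≡⟨ count-∷ P z F ⟩
      count P [ z ] + count P F
        ≡⟨ cong₂ _+_ single (count-split P Q F) ⟩
      (count (P ∩ Q) [ z ] + count (P ∩ ∁ Q) [ z ]) + (count (P ∩ Q) F + count (P ∩ ∁ Q) F)
        ≡⟨ swap (count (P ∩ Q) [ z ]) (count (P ∩ ∁ Q) [ z ]) (count (P ∩ Q) F) (count (P ∩ ∁ Q) F) ⟩
      (count (P ∩ Q) [ z ] + count (P ∩ Q) F) + (count (P ∩ ∁ Q) [ z ] + count (P ∩ ∁ Q) F)
        ≡⟨ cong₂ _+_ (count-∷ (P ∩ Q) z F) (count-∷ (P ∩ ∁ Q) z F) ⟨
      count (P ∩ Q) (z ∷ F) + count (P ∩ ∁ Q) (z ∷ F)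
        ∎
      where
      open ≡-Reasoning
      swap : ∀ a b c e → (a + b) + (c + e) ≡ (a + c) + (b + e)
      swap = solve-∀
      single : count P [ z ] ≡ count (P ∩ Q) [ z ] + count (P ∩ ∁ Q) [ z ]
      single with em {z ∈ P} | em {z ∈ Q}
      ... | no  z∉P | _       = sym (cong₂ _+_ (count-∉ (z∉P ∘ proj₁)) (count-∉ (z∉P ∘ proj₁)))
      ... | yes z∈P | yes z∈Q = sym (cong₂ _+_ (count-∈ (z∈P , z∈Q)) (count-∉ (λ (_ , z∉Q) → z∉Q z∈Q)))
      ... | yes z∈P | no  z∉Q = sym (cong₂ _+_ (count-∉ (z∉Q ∘ proj₂)) (count-∈ (z∈P , z∉Q)))

    -- `columnSum` totals the pairs (z, u) with u ∈ R z column by column. Induction on `F` bounds it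
    -- from below by rows, induction on `U` from above by columns.
    double-count : ∀ (P : Subset d) (R : ℤ^ d → Subset d) F U {M E} →
      (∀ z → z ∈ P → M ≤ count (R z) U) →
      (∀ u → u ∈ˡ U → count (λ z → u ∈ R z) F ≤ E) →
      M * count P F ≤ length U * E
    double-count P R F U {M} {E} rows columns = ≤-trans (by-rows F) (by-columns U columns)
      where
      open ≤-Reasoning
      columnSum : List (ℤ^ d) → List (ℤ^ d) → ℕ
      columnSum F U = sum (map (λ u → count (λ z → u ∈ R z) F) U)
      by-columns : ∀ U → (∀ u → u ∈ˡ U → count (λ z → u ∈ R z) F ≤ E) → columnSum F U ≤ length U * E
      by-columns []      _  = z≤n
      by-columns (u ∷ U) ub = +-mono-≤ (ub u (here refl)) (by-columns U (λ v v∈ → ub v (there v∈)))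
      columnSum-∷ : ∀ z F U → columnSum (z ∷ F) U ≡ count (R z) U + columnSum F U
      columnSum-∷ z F []      = refl
      columnSum-∷ z F (u ∷ U) = begin-equality
        count (λ y → u ∈ R y) (z ∷ F) + columnSum (z ∷ F) U
          ≡⟨ cong₂ _+_ (trans (count-∷ (λ y → u ∈ R y) z F) (cong (_+ count (λ y → u ∈ R y) F) indicator))
               (columnSum-∷ z F U) ⟩
        (count (R z) [ u ] + count (λ y → u ∈ R y) F) + (count (R z) U + columnSum F U)
          ≡⟨ swap (count (R z) [ u ]) (count (λ y → u ∈ R y) F) (count (R z) U) (columnSum F U) ⟩
        (count (R z) [ u ] + count (R z) U) + columnSum F (u ∷ U)
          ≡⟨ cong (_+ columnSum F (u ∷ U)) (count-∷ (R z) u U) ⟨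
        count (R z) (u ∷ U) + columnSum F (u ∷ U)
          ∎
        where
        swap : ∀ a b c e → (a + b) + (c + e) ≡ (a + c) + (b + e)
        swap = solve-∀
        indicator : count (λ y → u ∈ R y) [ z ] ≡ count (R z) [ u ]
        indicator with em {u ∈ R z}
        ... | yes _ = refl
        ... | no  _ = refl
      row : ∀ z → M * count P [ z ] ≤ count (R z) U
      row z with em {z ∈ P}
      ... | no  _   = ≤-trans (≤-reflexive (*-zeroʳ M)) z≤n
      ... | yes z∈P = ≤-trans (≤-reflexive (*-identityʳ M)) (rows z z∈P)
      by-rows : ∀ F → M * count P F ≤ columnSum F U
      by-rows []      = ≤-trans (≤-reflexive (*-zeroʳ M)) z≤n
      by-rows (z ∷ F) = begin
        M * count P (z ∷ F)                   ≡⟨ cong (M *_) (count-∷ P z F) ⟩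
        M * (count P [ z ] + count P F)       ≡⟨ *-distribˡ-+ M (count P [ z ]) (count P F) ⟩
        M * count P [ z ] + M * count P F     ≤⟨ +-mono-≤ (row z) (by-rows F) ⟩
        count (R z) U + columnSum F U         ≡⟨ columnSum-∷ z F U ⟨
        columnSum (z ∷ F) U                   ∎

    count-translate : ∀ (B : Subset d) x F → count B (translate x F) ≡ count (λ y → x ⊕ y ∈ B) F
    count-translate B x []      = refl
    count-translate B x (y ∷ F) = begin
      count B (x ⊕ y ∷ translate x F)                               ≡⟨ count-∷ B (x ⊕ y) _ ⟩
      count B [ x ⊕ y ] + count B (translate x F)                   ≡⟨ cong₂ _+_ indicator (count-translate B x F) ⟩
      count (λ y → x ⊕ y ∈ B) [ y ] + count (λ y → x ⊕ y ∈ B) F     ≡⟨ count-∷ (λ y → x ⊕ y ∈ B) y F ⟨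
      count (λ y → x ⊕ y ∈ B) (y ∷ F)                               ∎
      where
      open ≡-Reasoning
      indicator : count B [ x ⊕ y ] ≡ count (λ y → x ⊕ y ∈ B) [ y ]
      indicator with em {x ⊕ y ∈ B}
      ... | yes _ = refl
      ... | no  _ = refl

    -- Covered points and double counting of holes.

    Covered : Subset d → ℕ → ℕ → Subset d
    Covered C m k z = ｛ z ｝ ⊞ Cube k ⊆ C ⊞ Cube m

    ∉-Covered : ∀ {C m k z} → z ∉ Covered C m k → ∃ λ v → v ∈ Cube k × z ⊕ v ∉ C ⊞ Cube m
    ∉-Covered {C} {m} {k} {z} z∉ = ¬¬-elim λ none → z∉ λ
      { (_ , v , refl , v∈ , refl) → ¬¬-elim λ zv∉ → none (v , v∈ , zv∉) }

    -- If z + x + v lies outside A + B + Cube m, then z + v − y ∉ A + Cube m whenever x + y ∈ B.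
    holes : ∀ (A B : Subset d) m k K x {z} → z ∈ A ⊞ Cube m → z ⊕ x ∉ Covered (A ⊞ B) m k →
            count B (translate x (cube d K)) ≤
            count (λ u → z ∈ A ⊞ Cube m × z ⊕ u ∉ A ⊞ Cube m) (cube d (K + k))
    holes A B m k K x {z} z∈ z∉ with ∉-Covered z∉
    ... | v , v∈ , zxv∉ = ≤-trans (≤-reflexive (count-translate B x (cube d K)))
      -- The injection y ↦ v - y carries window points of `B` to holes around `z`; radius `K + k`
      -- leaves room for the shift by `v`.
      (count-injection (λ y → ⊝ y ⊕ v) (λ eq → ⊝-injective (⊕-cancelʳ v eq)) (cube-unique d K)
        (λ {y} y∈ xy∈B → ∈-cube⁺ (Cube-⊕ (Cube-⊝ (∈-cube⁻ y∈)) v∈) , z∈ ,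
          λ (a , e , a∈ , e∈ , eq) → zxv∉ (a ⊕ (x ⊕ y) , e , (a , x ⊕ y , a∈ , xy∈B , refl) , e∈ ,
            ⊕-regroup eq)))

    -- Points z of A_m split according to whether z + x is covered. Translation by `x` injects the
    -- good ones into the covered points. Each bad one sees at least as many holes as `B` has points
    -- in the window, and all holes are among the `e` new points, so double counting bounds the bad
    -- ones.
    transfer : ∀ (A B : Subset d) m k K x {s c n} → x ∈ Cube c → k ≤ K →
      volume d K < s * count B (translate x (cube d K)) →
      ∃ λ e →
        count (A ⊞ Cube m) (cube d n) ≤
          count (Covered (A ⊞ B) m k) (cube d (n + (K + k + c))) + (s * 2 ^ d) * e ×
        count (A ⊞ Cube m) (cube d n) + e ≤
          count (A ⊞ Cube (m + (K + k))) (cube d (n + (K + k + c)))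
    transfer A B m k K x {s} {c} {n} x∈ k≤K dense = e , upper , lower
      where
      open ≤-Reasoning
      n′ r β bad e : ℕ
      r  = K + k
      -- The margin `r` contains the holes, the margin `c` the translates by `x`.
      n′ = n + (r + c)
      Aₘ Aᵣ G T E : Subset d
      Aₘ = A ⊞ Cube m
      Aᵣ = A ⊞ Cube (m + r)
      G  = Covered (A ⊞ B) m k
      T  = Aₘ ∩ Cube n
      E  = Aᵣ ∩ ∁ T
      Bad : Subset d
      Bad z = z ∈ Aₘ × z ⊕ x ∉ G
      β   = count B (translate x (cube d K))
      bad = count Bad (cube d n)
      e   = count E (cube d n′)

      r≤r+c : n + r ≤ n′
      r≤r+c = +-monoʳ-≤ n (m≤m+n r c)
      c≤r+c : n + c ≤ n′
      c≤r+c = +-monoʳ-≤ n (m≤n+m c r)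

      many-holes : β * bad ≤ volume d r * e
      many-holes = subst (λ l → β * bad ≤ l * e) (length-cube d r)
        -- The relation repeats z ∈ `Aₘ`, so that each column knows that its holes z + u lie in
        -- `Aᵣ`.
        (double-count Bad (λ z u → z ∈ Aₘ × z ⊕ u ∉ Aₘ) (cube d n) (cube d r)
          (λ z (z∈ , zx∉) → holes A B m k K x z∈ zx∉)
          (λ u u∈ → count-injection (_⊕ u) (⊕-cancelʳ u) (cube-unique d n)
            (λ z∈ (z∈Aₘ , zu∉Aₘ) →
              ∈-cube⁺ (Cube-mono r≤r+c (Cube-⊕ (∈-cube⁻ z∈) (∈-cube⁻ u∈))) ,
              ⊞-Cube-⊕ z∈Aₘ (∈-cube⁻ u∈) , zu∉Aₘ ∘ proj₁)))

      few-bad : bad ≤ (s * 2 ^ d) * e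
      few-bad = *-cancelʳ-≤ bad (s * 2 ^ d * e) (volume d K) {{volume≢0 d K}} (begin
        bad * volume d K                   ≤⟨ *-monoʳ-≤ bad (<⇒≤ dense) ⟩
        bad * (s * β)                      ≡⟨ lem₁ bad s β ⟩
        s * (β * bad)                      ≤⟨ *-monoʳ-≤ s many-holes ⟩
        s * (volume d r * e)               ≤⟨ *-monoʳ-≤ s (*-monoˡ-≤ e (volume-double d k≤K)) ⟩
        s * (2 ^ d * volume d K * e)       ≡⟨ lem₂ s (2 ^ d) (volume d K) e ⟩
        s * 2 ^ d * e * volume d K         ∎)
        where
        lem₁ : ∀ b s β → b * (s * β) ≡ s * (β * b)
        lem₁ = solve-∀
        lem₂ : ∀ s t v e → s * (t * v * e) ≡ s * t * e * v
        lem₂ = solve-∀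

      upper : count Aₘ (cube d n) ≤ count G (cube d n′) + (s * 2 ^ d) * e
      upper = begin
        count Aₘ (cube d n)
          ≡⟨ count-split Aₘ (λ z → z ⊕ x ∈ G) (cube d n) ⟩
        count (Aₘ ∩ (λ z → z ⊕ x ∈ G)) (cube d n) + bad
          ≤⟨ +-mono-≤ (count-injection (_⊕ x) (⊕-cancelʳ x) (cube-unique d n)
               (λ z∈ (_ , zx∈G) → ∈-cube⁺ (Cube-mono c≤r+c (Cube-⊕ (∈-cube⁻ z∈) x∈)) , zx∈G)) few-bad ⟩
        count G (cube d n′) + (s * 2 ^ d) * e
          ∎

      lower : count Aₘ (cube d n) + e ≤ count Aᵣ (cube d n′)
      lower = begin
        count Aₘ (cube d n) + e
          ≤⟨ +-monoˡ-≤ e (count-injection (λ z → z) (λ eq → eq) (cube-unique d n) inside) ⟩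
        count (Aᵣ ∩ T) (cube d n′) + e
          ≡⟨ count-split Aᵣ T (cube d n′) ⟨
        count Aᵣ (cube d n′)
          ∎
        where
        inside : ∀ {z} → z ∈ˡ cube d n → z ∈ Aₘ → z ∈ˡ cube d n′ × z ∈ Aᵣ ∩ T
        inside z∈ z∈Aₘ@(a , u , a∈ , u∈ , eq) =
          ∈-cube⁺ (Cube-mono (m≤m+n n (r + c)) (∈-cube⁻ z∈)) ,
          (a , u , a∈ , Cube-mono (m≤m+n m r) u∈ , eq) , z∈Aₘ , ∈-cube⁻ z∈

    -- Upper density through rationals exceeded arbitrarily far out.

    </frequency : ∀ (X : Subset d) n F {i N} → i * volume d n < count X F * suc N → + i / suc N ℚ.< frequency X n F
    </frequency X n F {i} {N} = /-</ i (suc N) (count X F) (volume d n) {{_}} {{volume≢0 d n}}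

    </frequency⁻ : ∀ (X : Subset d) n F {i N} → + i / suc N ℚ.< frequency X n F → i * volume d n < count X F * suc N
    </frequency⁻ X n F {i} {N} = /-</⁻ i (suc N) (count X F) (volume d n) {{_}} {{volume≢0 d n}}

    -- This says that `r` lies below every tail supremum of the frequencies; `p ∈ below (d̄ X)`
    -- unfolds to some r > p with `Exceeds X r`.
    Exceeds : Subset d → ℚ → Set
    Exceeds X r = ∀ n → ∃ λ k → r ℚ.< frequency X (n + k) (cube d (n + k))

    Exceeds-≤ : ∀ {X r r′} → r′ ℚ.≤ r → Exceeds X r → Exceeds X r′
    Exceeds-≤ r′≤r ex n = let (k , r<f) = ex n in k , ℚ.≤-<-trans r′≤r r<f

    Exceeds-⊆ : ∀ {X Y r} → X ⊆ Y → Exceeds X r → Exceeds Y r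
    Exceeds-⊆ {X} {Y} X⊆Y ex n = let (k , r<f) = ex n in k , ℚ.<-≤-trans r<f (mono (n + k))
      where
      mono : ∀ n → frequency X n (cube d n) ℚ.≤ frequency Y n (cube d n)
      mono n = /-≤/ (count X (cube d n)) (volume d n) (count Y (cube d n)) (volume d n)
        {{volume≢0 d n}} {{volume≢0 d n}}
        (*-monoˡ-≤ (volume d n) (count-mono (cube-unique d n) (λ _ → X⊆Y)))

    ¬Exceeds-1 : ∀ {X r} → 1ℚ ℚ.≤ r → ¬ Exceeds X r
    ¬Exceeds-1 {X} 1≤r ex =
      let (k , r<f) = ex 0 in
      ℚ.<-irrefl refl (ℚ.<-≤-trans (frequency≤1 X k (cube d k) refl r<f) 1≤r)

    ¬Exceeds⇒bounded : ∀ {X r} → ¬ Exceeds X r →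
                       ∃ λ n → ∀ k → ¬ r ℚ.< frequency X (n + k) (cube d (n + k))
    ¬Exceeds⇒bounded ¬ex = ¬¬-elim λ none → ¬ex λ n →
      ¬¬-elim λ never → none (n , λ k r<f → never (k , r<f))

    -- Dense windows of `B` and the density of covered points.

    DenseWindows : Subset d → ℕ → Set
    DenseWindows B s = ∀ K₀ → ∃ λ K → K₀ ≤ K × ∃ λ x → volume d K < s * count B (translate x (cube d K))

    -- For rationals 0 < q₁ < q₂ < β, taking ε = q₁ in the limit makes the maximal frequency in all
    -- large cubes exceed q₂ - q₁, and 1/s is chosen at most this difference.
    BD>0⇒DenseWindows : ∀ {B β} → BD B ≈ β → 0ʳ <ʳ β → ∃ λ s → DenseWindows B s
    BD>0⇒DenseWindows {B} {β} lim (q , q∈ , q≮0) = suc N , windows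
      where
      q₁ q₂ : ℚ
      q₁ = proj₁ (open′ β q∈)
      q<q₁ : q ℚ.< q₁
      q<q₁ = proj₁ (proj₂ (open′ β q∈))
      q₁∈ : q₁ ∈ below β
      q₁∈ = proj₂ (proj₂ (open′ β q∈))
      q₂ = proj₁ (open′ β q₁∈)
      q₁<q₂ : q₁ ℚ.< q₂
      q₁<q₂ = proj₁ (proj₂ (open′ β q₁∈))
      q₂∈ : q₂ ∈ below β
      q₂∈ = proj₂ (proj₂ (open′ β q₁∈))
      q₁>0 : 0ℚ ℚ.< q₁
      q₁>0 = ℚ.≤-<-trans (ℚ.≮⇒≥ q≮0) q<q₁
      0<q₂-q₁ : 0ℚ ℚ.< q₂ ℚ.- q₁
      0<q₂-q₁ = subst (ℚ._< q₂ ℚ.- q₁) (ℚ.+-inverseʳ q₁) (ℚ.+-monoˡ-< (ℚ.- q₁) q₁<q₂)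
      reciprocal : ∃ λ N → + 1 / suc N ℚ.≤ q₂ ℚ.- q₁
      reciprocal = archimedean 0<q₂-q₁
      N = proj₁ reciprocal
      windows : DenseWindows B (suc N)
      windows K₀ = window (proj₂ (proj₂ (lim q₁ q₁>0) K (m≤m+n N₀ K₀)))
        where
        N₀ = proj₁ (lim q₁ q₁>0)
        K = N₀ + K₀
        window : β <ʳ maxFrequency B K +ʳ q₁ →
                 ∃ λ K → K₀ ≤ K × ∃ λ x → volume d K < suc N * count B (translate x (cube d K))
        window (r , (x , r-q₁<f) , r∉) = K , m≤n+m K₀ N₀ , x ,
          subst₂ _<_ (*-identityˡ (volume d K)) (*-comm (count B (translate x (cube d K))) (suc N))
            (</frequency⁻ B K (translate x (cube d K)) {1} {N} 1/N<f)
          where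
          q₂≤r : q₂ ℚ.≤ r
          q₂≤r = ℚ.≮⇒≥ (λ r<q₂ → r∉ (downward β r<q₂ q₂∈))
          1/N<f : + 1 / suc N ℚ.< frequency B K (translate x (cube d K))
          1/N<f = ℚ.≤-<-trans (ℚ.≤-trans (proj₂ reciprocal) (ℚ.+-monoˡ-≤ (ℚ.- q₁) q₂≤r)) r-q₁<f

    -- For given `k` the window, hence the margin `c′`, is fixed before the large cube is chosen, so
    -- the boundary becomes negligible and `budget` applies to the counts from `transfer`.
    Exceeds-Covered : ∀ {A B s} → DenseWindows B s → ∀ {m N j w} →
      Exceeds (A ⊞ Cube m) (+ j / suc N) →
      (∀ r → ¬ Exceeds (A ⊞ Cube r) (+ (j + 2) / suc N)) →
      w + (3 * (s * 2 ^ d) + 1) ≤ j →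
      ∀ k → Exceeds (Covered (A ⊞ B) m k) (+ w / suc N)
    Exceeds-Covered {A} {B} {s} dense {m} {N} {j} {w} ex none w≤j k n =
      let (K , k≤K , x , window) = dense k
          (c , x∈)               = Cube-exhaustive x
          c′                     = K + k + c
          (n₀ , shift)           = volume-shift d c′ N
          (n₁ , bounded)         = ¬Exceeds⇒bounded {A ⊞ Cube (m + (K + k))} {+ (j + 2) / suc N} (none (m + (K + k)))
          -- Beyond `n₀` the margin hardly changes the volume; beyond `n₁` the larger thickening
          -- stays at or below level `j + 2`.
          (k₀ , j/N<f)           = ex (n + (n₀ + n₁))
          n′                     = n + (n₀ + n₁) + k₀
          (e , upper , lower)    = transfer A B m k K x {s} {c} {n′} x∈ k≤K window
      in
      n₀ + n₁ + k₀ + c′ ,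
      subst (λ t → + w / suc N ℚ.< frequency G t (cube d t)) (reassoc₀ n n₀ n₁ k₀ c′)
        (</frequency G (n′ + c′) (cube d (n′ + c′)) {w} {N}
          (budget {j} {w} {s * 2 ^ d} {suc N} {volume d n′} {volume d (n′ + c′)}
            {count (A ⊞ Cube m) (cube d n′)} {e}
            {count G (cube d (n′ + c′))} {count (A ⊞ Cube (m + (K + k))) (cube d (n′ + c′))}
            (</frequency⁻ (A ⊞ Cube m) n′ (cube d n′) {j} {N} j/N<f)
            (bounded⇒≤ (A ⊞ Cube (m + (K + k))) (n′ + c′)
              (subst (λ t → ¬ + (j + 2) / suc N ℚ.< frequency (A ⊞ Cube (m + (K + k))) t (cube d t))
                (reassoc₁ n n₀ n₁ k₀ c′) (bounded (n + n₀ + k₀ + c′))))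
            (count≤volume (A ⊞ Cube m) n′)
            (volume-mono d (m≤m+n n′ c′))
            (shift n′ (≤-trans (≤-trans (m≤m+n n₀ n₁) (m≤n+m (n₀ + n₁) n)) (m≤m+n _ k₀)))
            upper lower w≤j))
      where
      G : Subset d
      G = Covered (A ⊞ B) m k
      reassoc₀ : ∀ n n₀ n₁ k₀ c′ → n + (n₀ + n₁) + k₀ + c′ ≡ n + (n₀ + n₁ + k₀ + c′)
      reassoc₀ = solve-∀
      reassoc₁ : ∀ n n₀ n₁ k₀ c′ → n₁ + (n + n₀ + k₀ + c′) ≡ n + (n₀ + n₁) + k₀ + c′
      reassoc₁ = solve-∀
      count≤volume : ∀ X n → count X (cube d n) ≤ volume d n
      count≤volume X n = ≤-trans (length-filter _ (cube d n)) (≤-reflexive (length-cube d n))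
      bounded⇒≤ : ∀ (X : Subset d) n → ¬ + (j + 2) / suc N ℚ.< frequency X n (cube d n) →
                  count X (cube d n) * suc N ≤ (j + 2) * volume d n
      bounded⇒≤ X n ¬lt = ≮⇒≥ (λ lt → ¬lt (</frequency X n (cube d n) {j + 2} {N} lt))

    -- Choice of the thickening on a grid of rational levels.

    -- The multiples of 1/(N + 1) are climbed up to a level that some thickening exceeds while none
    -- exceeds the next. The climb ends because no frequency exceeds 1.
    grid : ∀ A M {p q} → 0ℚ ℚ.≤ p → p ℚ.< q → ∀ {l} → Exceeds (A ⊞ Cube l) q →
      ∃ λ N → ∃₂ λ w i → p ℚ.< + w / suc N × w + M ≤ i ×
        (∃ λ m → Exceeds (A ⊞ Cube m) (+ i / suc N)) ×
        (∀ r → ¬ Exceeds (A ⊞ Cube r) (+ suc i / suc N))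
    grid A M {p} {q} 0≤p p<q {l} ex =
      let (N , w , u , p<w , u≤q , w+M≤u) = common-denominator M 0≤p p<q
          (i , at-i , ¬at-suc-i) = last (At N) (l , up-to N u u≤q z≤n) (suc N) (¬at-top N)
      in
      N , w , i , p<w ,
      -- Were i < u, level `suc i` would be at most `q` and so still be exceeded by `A ⊞ Cube l`.
      ≤-trans w+M≤u (≮⇒≥ λ i<u → ¬at-suc-i (l , up-to N u u≤q i<u)) , at-i ,
      λ r ex′ → ¬at-suc-i (r , ex′)
      where
      At : ℕ → ℕ → Set
      At N i = ∃ λ m → Exceeds (A ⊞ Cube m) (+ i / suc N)
      ¬at-top : ∀ N → ¬ At N (suc N)
      ¬at-top N (m , ex) = ¬Exceeds-1 {A ⊞ Cube m} {+ suc N / suc N}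
        (/-≤/ 1 1 (suc N) (suc N) (≤-reflexive (*-comm 1 (suc N)))) ex
      up-to : ∀ N u {i} → + u / suc N ℚ.≤ q → i ≤ u → Exceeds (A ⊞ Cube l) (+ i / suc N)
      up-to N u {i} u≤q i≤u = Exceeds-≤ {A ⊞ Cube l} {q} {+ i / suc N}
        (ℚ.≤-trans (/-≤/ i (suc N) u (suc N) (*-monoˡ-≤ (suc N) i≤u)) u≤q) ex

    -- No thickening gains more than two grid steps over level `j`, and `M` steps separate `w` from
    -- `j` to absorb the loss. The second step of the gap lets `refine` drop one level.
    Saturated : Subset d → ℕ → ℕ → ℚ → Set
    Saturated A M m p = ∃ λ N → ∃₂ λ w j → p ℚ.< + w / suc N × w + M ≤ j ×
      Exceeds (A ⊞ Cube m) (+ j / suc N) ×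
      (∀ r → ¬ Exceeds (A ⊞ Cube r) (+ (j + 2) / suc N))

    Saturated-≤ : ∀ {A M m p p′} → p′ ℚ.≤ p → Saturated A M m p → Saturated A M m p′
    Saturated-≤ p′≤p (N , w , j , p<w , rest) = N , w , j , ℚ.≤-<-trans p′≤p p<w , rest

    -- Either thickening A never raises its density above α, and then no thickening is
    -- needed, or some thickening raises it strictly and a fixed grid is fine enough.
    saturation : ∀ {A α} → d̄ A ≈ʳ α → 0ʳ <ʳ α → ∀ M → ∃ λ m → ∀ p → p ∈ below α → Saturated A M m p
    saturation {A} {α} (d̄≤α , α≤d̄) (q₀ , q₀∈ , q₀≮0) M = by-cases em
      where
      Raised : Set
      Raised = ∃₂ λ l r → r ∈ below (d̄ (A ⊞ Cube l)) × r ∉ below α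

      ≤-outside : ∀ {p r} → r ∉ below α → p ∈ below α → p ℚ.≤ r
      ≤-outside r∉ p∈ = ℚ.≮⇒≥ (λ r<p → r∉ (downward α r<p p∈))

      0≤q₀ : 0ℚ ℚ.≤ q₀
      0≤q₀ = ℚ.≮⇒≥ q₀≮0

      -- Since `r` is outside the cut of α, a level above `r` beats every `p` in it: one grid and
      -- one `m` serve all `p`.
      coarse : Raised → ∃ λ m → ∀ p → p ∈ below α → Saturated A M m p
      coarse (l , r , (r₀ , r<r₀ , ex) , r∉) =
        let (N , w , i , r<w , w≤i , (m , exₘ) , none) =
              grid A M (ℚ.≤-trans 0≤q₀ (≤-outside r∉ q₀∈)) r<r₀ {l} ex
        in
        m , λ p p∈ → N , w , i , ℚ.≤-<-trans (≤-outside r∉ p∈) r<w , w≤i , exₘ ,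
        λ s ex′ → none s (Exceeds-≤ {A ⊞ Cube s} {+ (i + 2) / suc N} {+ suc i / suc N}
          (/-≤/ (suc i) (suc N) (i + 2) (suc N)
            (*-monoˡ-≤ (suc N) (≤-trans (n≤1+n (suc i)) (≤-reflexive (+-comm 2 i))))) ex′)

      module _ (¬raised : ¬ Raised) where

        at-α : ∀ {p} → p ∈ below α → ∃ λ q → p ℚ.< q × Exceeds (A ⊞ Cube 0) q
        at-α p∈ = let (q , p<q , ex) = α≤d̄ p∈ in q , p<q , Exceeds-⊆ {A} {A ⊞ Cube 0} {q} (⊆-⊞-Cube 0) ex

        -- A rational below the density of a thickening is below α, hence below the density of `A`
        -- itself; passing from `s` to a smaller `r` accounts for the strictness of cuts.
        not-raised : ∀ l {r s} → r ℚ.< s → Exceeds (A ⊞ Cube l) s → Exceeds (A ⊞ Cube 0) r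
        not-raised l {r} {s} r<s ex =
          let (q , r<q , ex₀) = at-α (¬¬-elim λ r∉ → ¬raised (l , r , (s , r<s , ex) , r∉)) in
          Exceeds-≤ {A ⊞ Cube 0} {q} {r} (ℚ.<⇒≤ r<q) ex₀

        -- Dropping from level `suc j` to `j` replaces the thickening by radius 0; `suc M` pays for
        -- this extra step and rules out level 0.
        refine : ∀ {p} N w i → p ℚ.< + w / suc N → w + suc M ≤ i →
          (∃ λ m → Exceeds (A ⊞ Cube m) (+ i / suc N)) →
          (∀ r → ¬ Exceeds (A ⊞ Cube r) (+ suc i / suc N)) → Saturated A M 0 p
        refine N w zero    _   w≤i _        _    = ⊥-elim (n≮0 (≤-trans (m≤n+m (suc M) w) w≤i))
        refine N w (suc j) p<w w≤i (l , ex) none =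
          N , w , j , p<w , s≤s⁻¹ (≤-trans (≤-reflexive (sym (+-suc w M))) w≤i) ,
          not-raised l {+ j / suc N} {+ suc j / suc N}
            (/-</ j (suc N) (suc j) (suc N) (*-monoˡ-< (suc N) (n<1+n j))) ex ,
          λ r ex′ → none r (subst (λ t → Exceeds (A ⊞ Cube r) (+ t / suc N)) (+-comm j 2) ex′)

        fine-nonNeg : ∀ {p} → 0ℚ ℚ.≤ p → p ∈ below α → Saturated A M 0 p
        fine-nonNeg 0≤p p∈ =
          let (q , p<q , ex) = at-α p∈
              (N , w , i , p<w , w≤i , at-i , none) = grid A (suc M) 0≤p p<q {0} ex
          in refine N w i p<w w≤i at-i none

        fine : ∀ p → p ∈ below α → Saturated A M 0 p
        fine p p∈ = [ (λ 0≤p → fine-nonNeg 0≤p p∈)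
                    -- `grid` needs a nonnegative start, so for p ≤ 0 the rational `q₀ ≥ 0` in the
                    -- cut of α stands in.
                    , (λ p≤0 → Saturated-≤ {A} {M} {0} (ℚ.≤-trans p≤0 0≤q₀) (fine-nonNeg 0≤q₀ q₀∈))
                    ]′ (ℚ.≤-total 0ℚ p)

      by-cases : Dec Raised → ∃ λ m → ∀ p → p ∈ below α → Saturated A M m p
      by-cases (yes raised) = coarse raised
      by-cases (no ¬raised) = 0 , fine ¬raised

-- Upper syndeticity of the sumset.

theorem3p4 :
    (em : ExcludedMiddle 0ℓ) → let open Density em in
    (d : ℕ) → 1 ≤ d → (A B : Subset d) (α β : ℝ) →
    d̄ A ≈ʳ α → 0ʳ <ʳ α → BD B ≈ β → 0ʳ <ʳ β →
    UpperSyndetic α (A ⊞ B)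
theorem3p4 em d _ A B α β d̄A≈α α>0 BDB≈β β>0 =
  let (s , dense)  = BD>0⇒DenseWindows em {d} {B} {β} BDB≈β β>0
      -- The constant is the loss 3C + 1 of `budget` with C = s 2^d; it is independent of `k` and
      -- `p`, and so is `m`.
      (m , levels) = saturation em {d} {A} {α} d̄A≈α α>0 (3 * (s * 2 ^ d) + 1)
  in
  α>0 , α≤1 , m , λ k _ {p} p∈ →
    let (N , w , j , p<w , w≤j , ex , none) = levels p p∈ in
    + w / suc N , p<w , Exceeds-Covered em {d} {A} {B} {s} dense {m} {N} {j} {w} ex none w≤j k
  where
  open Density em
  α≤1 : α ≤ʳ 1ʳ
  α≤1 q∈ = let (r , q<r , ex) = proj₂ d̄A≈α q∈ ; (k , r<f) = ex 0 in
    ℚ.<-trans q<r (frequency≤1 A k (cube d k) refl r<f)
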